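{- In the Majority Model (MM) on the cycle $C_n=(v_0,\dots,v_{n-1})$, the number of stable colorings is $\Theta(\Phi^n)$, where $\Phi=\frac{1+\sqrt5}{2}$ is the golden ratio.
   Context: A coloring is a map from the nodes to $\{b,w\}$. In MM, all nodes update simultaneously: a node adopts the color strictly more frequent among its neighbors in the previous round and keeps its color in case of a tie. A coloring is stable if one application of the MM update rule returns the same coloring. -}

module Defs where

open import Data.Fin using (Fin; toℕ)
open import Data.Integer using (+_)
open import Data.List using (List; []; _∷_; [_]; length; filter; allFin; cartesianProductWith)
open import Data.List.Membership.Propositional using (_∈_)
open import Data.List.Membership.Propositional.Properties using (∈-cartesianProductWith⁺)
open import Data.List.Relation.Unary.All using ([]; _∷_)
open import Data.List.Relation.Unary.AllPairs using ([]; _∷_)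
open import Data.List.Relation.Unary.Any using (here; there)
open import Data.List.Relation.Unary.Unique.Propositional using (Unique)
open import Data.List.Relation.Unary.Unique.Propositional.Properties using (cartesianProductWith⁺)
open import Data.Nat using (ℕ; zero; suc; s≤s) renaming (_≤_ to _≤ℕ_)
open import Data.Nat.Properties using (<-cmp; 1+n≢n) renaming (_≟_ to _≟ℕ_)
open import Data.Product using (_×_; _,_)
open import Data.Rational using (ℚ; 0ℚ; 1ℚ; ½; _/_) renaming (_+_ to _+ℚ_; _-_ to _-ℚ_; _*_ to _*ℚ_; _≤_ to _≤ℚ_)
open import Data.Sum using (_⊎_; inj₁; inj₂; swap)
open import Data.Vec using (Vec; []; _∷_; lookup; tabulate)
open import Data.Vec.Properties using (≡-dec; ∷-injective)
open import Relation.Binary.Definitions using (tri<; tri≈; tri>)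
open import Relation.Binary.PropositionalEquality using (_≡_; _≢_; refl; sym; trans; cong)
open import Relation.Nullary using (¬_; Dec; yes; no)
open import Relation.Nullary.Decidable using (_×-dec_; _⊎-dec_)

record Graph (n : ℕ) : Set₁ where
  field
    Adj    : Fin n → Fin n → Set
    adj?   : ∀ u v → Dec (Adj u v)
    symm   : ∀ {u v} → Adj u v → Adj v u
    irrefl : ∀ {v} → ¬ Adj v v

-- Next i j : j ≡ i + 1 (mod n)
Next : ∀ {n} → Fin n → Fin n → Set
Next {n} i j = (toℕ j ≡ suc (toℕ i)) ⊎ (suc (toℕ i) ≡ n × toℕ j ≡ 0)

next? : ∀ {n} (i j : Fin n) → Dec (Next i j)
next? {n} i j =
  (toℕ j ≟ℕ suc (toℕ i)) ⊎-dec ((suc (toℕ i) ≟ℕ n) ×-dec (toℕ j ≟ℕ 0))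

next-irrefl : ∀ {n} → 3 ≤ℕ n → {i : Fin n} → ¬ Next i i
next-irrefl h (inj₁ e) = 1+n≢n (sym e)
next-irrefl h (inj₂ (e , z)) with trans (sym e) (cong suc z)
next-irrefl (s≤s ()) (inj₂ _) | refl

cycle : (n : ℕ) → 3 ≤ℕ n → Graph n
cycle n 3≤n = record
  { Adj    = λ i j → Next i j ⊎ Next j i
  ; adj?   = λ i j → next? i j ⊎-dec next? j i
  ; symm   = swap
  ; irrefl = λ { (inj₁ p) → next-irrefl 3≤n p ; (inj₂ p) → next-irrefl 3≤n p }
  }

data Color : Set where
  b w : Color

_≟ᶜ_ : (x y : Color) → Dec (x ≡ y)
b ≟ᶜ b = yes refl
b ≟ᶜ w = no λ ()
w ≟ᶜ b = no λ ()
w ≟ᶜ w = yes refl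

Coloring : ℕ → Set
Coloring n = Vec Color n

module _ {n : ℕ} (G : Graph n) where
  open Graph G

  neighborsWithColor : Coloring n → Fin n → Color → ℕ
  neighborsWithColor c v x =
    length (filter (λ u → adj? v u ×-dec (lookup c u ≟ᶜ x)) (allFin n))

  newColor : Coloring n → Fin n → Color
  newColor c v with <-cmp (neighborsWithColor c v b) (neighborsWithColor c v w)
  ... | tri< _ _ _ = w
  ... | tri≈ _ _ _ = lookup c v
  ... | tri> _ _ _ = b

  majorityStep : Coloring n → Coloring n
  majorityStep c = tabulate (newColor c)

  Stable : Coloring n → Set
  Stable c = majorityStep c ≡ c

  stable? : (c : Coloring n) → Dec (Stable c)
  stable? c = ≡-dec _≟ᶜ_ (majorityStep c) c

allColorings : (n : ℕ) → List (Coloring n)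
allColorings zero    = [ [] ]
allColorings (suc n) = cartesianProductWith _∷_ (b ∷ w ∷ []) (allColorings n)

allColorings-complete : ∀ {n} (c : Coloring n) → c ∈ allColorings n
allColorings-complete []      = here refl
allColorings-complete (b ∷ c) =
  ∈-cartesianProductWith⁺ _∷_ {xs = b ∷ w ∷ []} (here refl) (allColorings-complete c)
allColorings-complete (w ∷ c) =
  ∈-cartesianProductWith⁺ _∷_ {xs = b ∷ w ∷ []} (there (here refl)) (allColorings-complete c)

allColorings-unique : ∀ n → Unique (allColorings n)
allColorings-unique zero    = [] ∷ []
allColorings-unique (suc n) =
  cartesianProductWith⁺ _∷_ ∷-injective (((λ ()) ∷ []) ∷ [] ∷ []) (allColorings-unique n)

numStable : ∀ {n} → Graph n → ℕ
numStable {n} G = length (filter (stable? G) (allColorings n))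

-- The ordered subfield ℚ(√5) of the reals; a +√5 r stands for a + r·√5, and
-- since √5 is irrational, _≡_ on pairs is equality of the denoted reals.
infix 10 _+√5_
record ℚ√5 : Set where
  constructor _+√5_
  field
    rat  : ℚ
    coef : ℚ
open ℚ√5 public

infixl 6 _⊕_ _⊖_
infixl 7 _⊗_
infixr 8 _^√_
infix  4 _≼_ _≺_

5ℚ : ℚ
5ℚ = + 5 / 1

_⊕_ _⊖_ _⊗_ : ℚ√5 → ℚ√5 → ℚ√5
(p +√5 q) ⊕ (r +√5 s) = (p +ℚ r) +√5 (q +ℚ s)
(p +√5 q) ⊖ (r +√5 s) = (p -ℚ r) +√5 (q -ℚ s)
(p +√5 q) ⊗ (r +√5 s) = (p *ℚ r +ℚ 5ℚ *ℚ (q *ℚ s)) +√5 (p *ℚ s +ℚ q *ℚ r)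

fromℚ : ℚ → ℚ√5
fromℚ p = p +√5 0ℚ

fromℕ : ℕ → ℚ√5
fromℕ n = fromℚ (+ n / 1)

0# 1# √5 Φ : ℚ√5
0# = fromℚ 0ℚ
1# = fromℚ 1ℚ
√5 = 0ℚ +√5 1ℚ
Φ  = (1# ⊕ √5) ⊗ fromℚ ½

_^√_ : ℚ√5 → ℕ → ℚ√5
x ^√ zero  = 1#
x ^√ suc n = x ⊗ x ^√ n

-- p + q√5 ≥ 0 as a real number iff |q|√5 ≤ p or |p| ≤ q√5;
-- the absolute values and √5 are removed by squaring.
NonNeg : ℚ√5 → Set
NonNeg (p +√5 q) =
  (0ℚ ≤ℚ p × 5ℚ *ℚ (q *ℚ q) ≤ℚ p *ℚ p) ⊎ (0ℚ ≤ℚ q × p *ℚ p ≤ℚ 5ℚ *ℚ (q *ℚ q))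

_≼_ _≺_ : ℚ√5 → ℚ√5 → Set
x ≼ y = NonNeg (y ⊖ x)
x ≺ y = x ≼ y × x ≢ y

√5²≡5 : √5 ⊗ √5 ≡ fromℕ 5
√5²≡5 = refl

Φ²≡Φ+1 : Φ ⊗ Φ ≡ Φ ⊕ 1#
Φ²≡Φ+1 = refl

{-# OPTIONS --safe #-}
module Submission where

-- A coloring of a cycle is stable iff every vertex agrees with one of its two neighbors.
-- Reading the colors along the cycle, a vertex that repeats its predecessor may be followed
-- by either color, while one that differs from it must be repeated; so the colorings of a
-- path in which every inner vertex agrees with a neighbor obey the Fibonacci recursion.
-- Cutting the cycle open gives F(n-1) ≤ S(n) ≤ 2 F(n+1), the lower bound coming from
-- colorings that begin with bb, for which the first vertex is automatically content.
-- Finally Φ^(n+1) = F(n) + F(n+1) Φ turns these bounds into multiples of Φ^n.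

open import Defs
open import Data.Nat using (ℕ; _≤_)
open import Data.Product using (_×_; ∃-syntax)

open import Data.Nat using (zero; suc; 2+; _+_; _<_; z≤n; s≤s)
open import Data.Nat.Properties as ℕ using (<-cmp)
open import Data.Fin using (Fin; zero; suc; toℕ; inject₁)
open import Data.Fin.Properties using (toℕ-injective; toℕ-inject₁; toℕ-fromℕ; toℕ<n)
open import Data.Integer as ℤ using (+_)
import Data.Integer.Properties as ℤ
open import Data.List using (List; []; _∷_; length; filter; map; _++_; allFin)
open import Data.List.Properties using (filter-++; filter-some; filter-none; length-filter; length-++; ++-identityʳ)
open import Data.List.Membership.Propositional.Properties using (∈-allFin; ∈-filter⁻)
open import Data.List.Relation.Binary.Sublist.Propositional using (⊆-refl)
open import Data.List.Relation.Binary.Sublist.Propositional.Properties using (length-mono-≤) renaming (filter⁺ to ⊆-filter⁺)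
open import Data.List.Relation.Unary.All as All using (All; _∷_)
open import Data.List.Relation.Unary.AllPairs using (_∷_)
import Data.List.Relation.Unary.Any as Any
open import Data.List.Relation.Unary.Unique.Propositional using (Unique)
open import Data.List.Relation.Unary.Unique.Propositional.Properties using (allFin⁺; filter⁺)
open import Data.Product using (_,_; proj₁; proj₂)
open import Data.Rational using (ℚ; 0ℚ; ½; _/_; toℚᵘ; nonNegative) renaming (_+_ to _+ℚ_; _-_ to _-ℚ_; -_ to -ℚ_; _*_ to _*ℚ_; _≤_ to _≤ℚ_)
open import Data.Rational.Properties as ℚ using (toℚᵘ-injective; toℚᵘ-fromℚᵘ; toℚᵘ-homo-+)
open import Data.Rational.Solver using (module +-*-Solver)
open import Data.Rational.Unnormalised as ℚᵘ using (mkℚᵘ; *≡*)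
import Data.Rational.Unnormalised.Properties as ℚᵘ
open import Data.Sum using (_⊎_; inj₁; inj₂)
open import Data.Vec using ([]; _∷_; lookup; _∷ʳ_)
open import Data.Vec.Properties using (lookup∘tabulate; tabulate∘lookup; tabulate-cong)
open import Function using (_∘_)
open import Level using (0ℓ)
open import Relation.Binary.Definitions using (tri<; tri≈; tri>)
open import Relation.Binary.PropositionalEquality using (_≡_; _≢_; refl; sym; trans; cong; cong₂; subst; subst₂; module ≡-Reasoning)
import Relation.Binary.Reasoning.Setoid as SetoidReasoning
open import Relation.Nullary using (¬_; Dec; yes; no; contradiction)
open import Relation.Nullary.Decidable using (_×-dec_; _⊎-dec_)
open import Relation.Unary using (Pred; Decidable)

-- Majority dynamics on a cycle

other : Color → Color
other b = w
other w = b

≢⇒other : ∀ {x y} → y ≢ x → y ≡ other x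
≢⇒other {b} {b} y≢x = contradiction refl y≢x
≢⇒other {b} {w} _   = refl
≢⇒other {w} {b} _   = refl
≢⇒other {w} {w} y≢x = contradiction refl y≢x

other-≢ : ∀ {x} → x ≢ other x
other-≢ {b} ()
other-≢ {w} ()

unique-constant⇒length≤1 : ∀ {A : Set} {xs : List A} {a : A} →
  Unique xs → All (_≡ a) xs → length xs ≤ 1
unique-constant⇒length≤1 {xs = []}         _ _ = z≤n
unique-constant⇒length≤1 {xs = _ ∷ []}     _ _ = s≤s z≤n
unique-constant⇒length≤1 {xs = _ ∷ _ ∷ _} ((x≢y ∷ _) ∷ _) (x≡a ∷ y≡a ∷ _) =
  contradiction (trans x≡a (sym y≡a)) x≢y

module _ {n : ℕ} (G : Graph n) (c : Coloring n) (v : Fin n) where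
  open Graph G

  private
    # : Color → ℕ
    # = neighborsWithColor G c v

    hasColor? : ∀ x u → Dec (Adj v u × lookup c u ≡ x)
    hasColor? x u = adj? v u ×-dec (lookup c u ≟ᶜ x)

  neighborsWithColor≥1 : ∀ {x} u → Adj v u → lookup c u ≡ x → 1 ≤ # x
  neighborsWithColor≥1 {x} u a e =
    filter-some (hasColor? x) (Any.map (λ { refl → a , e }) (∈-allFin u))

  neighborsWithColor≡0 : ∀ {x} → (∀ u → Adj v u → lookup c u ≢ x) → # x ≡ 0
  neighborsWithColor≡0 {x} h =
    cong length (filter-none (hasColor? x) (All.universal (λ u (a , e) → h u a e) (allFin n)))

  neighborsWithColor≤1 : ∀ {x} r → (∀ u → Adj v u → lookup c u ≡ x → u ≡ r) → # x ≤ 1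
  neighborsWithColor≤1 {x} r h = unique-constant⇒length≤1
    (filter⁺ (hasColor? x) (allFin⁺ n))
    (All.tabulate λ u∈ → let a , e = proj₂ (∈-filter⁻ (hasColor? x) {xs = allFin n} u∈) in h _ a e)

  -- A tie also keeps the color, so the weak inequality is enough here, whereas `newColor-flip`
  -- takes the strict one.
  newColor-keep : ∀ {x} → lookup c v ≡ x → # (other x) ≤ # x → newColor G c v ≡ x
  newColor-keep {b} e h with <-cmp (# b) (# w)
  ... | tri< l _ _ = contradiction h (ℕ.<⇒≱ l)
  ... | tri≈ _ _ _ = e
  ... | tri> _ _ _ = refl
  newColor-keep {w} e h with <-cmp (# b) (# w)
  ... | tri< _ _ _ = refl
  ... | tri≈ _ _ _ = e
  ... | tri> _ _ l = contradiction h (ℕ.<⇒≱ l)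

  newColor-flip : ∀ {x} → # x < # (other x) → newColor G c v ≡ other x
  newColor-flip {b} h with <-cmp (# b) (# w)
  ... | tri< _ _ _ = refl
  ... | tri≈ l _ _ = contradiction h l
  ... | tri> l _ _ = contradiction h l
  newColor-flip {w} h with <-cmp (# b) (# w)
  ... | tri< _ _ l = contradiction h l
  ... | tri≈ _ _ l = contradiction h l
  ... | tri> _ _ _ = refl

Next-functional : ∀ {n} {i j k : Fin n} → Next i j → Next i k → j ≡ k
Next-functional (inj₁ p) (inj₁ q) = toℕ-injective (trans p (sym q))
Next-functional {j = j} (inj₁ p) (inj₂ (q , _)) = contradiction (trans p q) (ℕ.<⇒≢ (toℕ<n j))
Next-functional {k = k} (inj₂ (p , _)) (inj₁ q) = contradiction (trans q p) (ℕ.<⇒≢ (toℕ<n k))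
Next-functional (inj₂ (_ , p)) (inj₂ (_ , q)) = toℕ-injective (trans p (sym q))

Next-injective : ∀ {n} {i j k : Fin n} → Next i k → Next j k → i ≡ j
Next-injective (inj₁ p) (inj₁ q) = toℕ-injective (ℕ.suc-injective (trans (sym p) q))
Next-injective (inj₁ p) (inj₂ (_ , q)) with () ← trans (sym p) q
Next-injective (inj₂ (_ , p)) (inj₁ q) with () ← trans (sym q) p
Next-injective (inj₂ (p , _)) (inj₂ (q , _)) = toℕ-injective (ℕ.suc-injective (trans p (sym q)))

Agrees : Color → Color → Color → Set
Agrees x y z = y ≡ x ⊎ y ≡ z

agrees? : ∀ x y z → Dec (Agrees x y z)
agrees? x y z = (y ≟ᶜ x) ⊎-dec (y ≟ᶜ z)

module _ {n : ℕ} (3≤n : 3 ≤ n) (c : Coloring n) {l v r : Fin n}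
         (l→v : Next l v) (v→r : Next v r) where

  private
    C : Graph n
    C = cycle n 3≤n

  -- The only neighbors are `l` and `r`. If one of them shares the color of `v`, then at least one
  -- neighbor is for that color and at most the remaining one is against it.
  agrees⇒kept : Agrees (lookup c l) (lookup c v) (lookup c r) → newColor C c v ≡ lookup c v
  agrees⇒kept (inj₁ v≡l) = newColor-keep C c v refl (ℕ.≤-trans
    (neighborsWithColor≤1 C c v r λ
      { u (inj₁ v→u) _ → Next-functional v→u v→r
      ; u (inj₂ u→v) e → contradiction
          (trans v≡l (trans (cong (lookup c) (Next-injective l→v u→v)) e)) other-≢ })
    (neighborsWithColor≥1 C c v l (inj₂ l→v) (sym v≡l)))
  agrees⇒kept (inj₂ v≡r) = newColor-keep C c v refl (ℕ.≤-trans
    (neighborsWithColor≤1 C c v l λ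
      { u (inj₁ v→u) e → contradiction
          (trans v≡r (trans (cong (lookup c) (Next-functional v→r v→u)) e)) other-≢
      ; u (inj₂ u→v) _ → Next-injective u→v l→v })
    (neighborsWithColor≥1 C c v r (inj₁ v→r) (sym v≡r)))

  -- By contraposition: if `l` and `r` both differ from `v`, its own color counts 0 and the other
  -- color at least 1, so `v` flips.
  kept⇒agrees : newColor C c v ≡ lookup c v → Agrees (lookup c l) (lookup c v) (lookup c r)
  kept⇒agrees kept with lookup c v ≟ᶜ lookup c l | lookup c v ≟ᶜ lookup c r
  ... | yes e | _     = inj₁ e
  ... | no  _ | yes e = inj₂ e
  ... | no v≢l | no v≢r = contradiction (trans (sym kept) flipped) other-≢
    where
    none : ∀ u → Graph.Adj C v u → lookup c u ≢ lookup c v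
    none u (inj₁ v→u) e = v≢r (trans (sym e) (cong (lookup c) (Next-functional v→u v→r)))
    none u (inj₂ u→v) e = v≢l (trans (sym e) (cong (lookup c) (Next-injective u→v l→v)))

    flipped : newColor C c v ≡ other (lookup c v)
    flipped = newColor-flip C c v (subst (_< neighborsWithColor C c v (other (lookup c v)))
      (sym (neighborsWithColor≡0 C c v none))
      (neighborsWithColor≥1 C c v r (inj₁ v→r) (≢⇒other (v≢r ∘ sym))))

stable⇒kept : ∀ {n} (G : Graph n) (c : Coloring n) → Stable G c → ∀ v → newColor G c v ≡ lookup c v
stable⇒kept G c s v = trans (sym (lookup∘tabulate (newColor G c) v)) (cong (λ c′ → lookup c′ v) s)

kept⇒stable : ∀ {n} (G : Graph n) (c : Coloring n) → (∀ v → newColor G c v ≡ lookup c v) → Stable G c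
kept⇒stable G c h = trans (tabulate-cong h) (tabulate∘lookup c)

-- Opening the cycle into a path

-- On the path p, q, xs, z every vertex strictly between p and z agrees with one of its neighbors.
Smooth : Color → Color → Color → ∀ {m} → Coloring m → Set
Smooth z p q []       = Agrees p q z
Smooth z p q (x ∷ xs) = Agrees p q x × Smooth z q x xs

smooth? : ∀ z p q {m} → Decidable (Smooth z p q {m})
smooth? z p q []       = agrees? p q z
smooth? z p q (x ∷ xs) = agrees? p q x ×-dec smooth? z q x xs

module _ (z : Color) where
  -- The three sequences are shifted against each other so that position `j` reads the predecessor,
  -- the vertex and the successor. This indexed form matches stability vertex by vertex.
  PointwiseSmooth : ∀ {m} → Color → Color → Coloring m → Set
  PointwiseSmooth {m} p q xs = (j : Fin (suc m)) →
    Agrees (lookup (p ∷ q ∷ xs) (inject₁ j)) (lookup (q ∷ xs) j) (lookup (xs ∷ʳ z) j)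

  smooth⇒pointwise : ∀ {m} p q (xs : Coloring m) → Smooth z p q xs → PointwiseSmooth p q xs
  smooth⇒pointwise p q []       a       zero    = a
  smooth⇒pointwise p q (x ∷ xs) (a , _) zero    = a
  smooth⇒pointwise p q (x ∷ xs) (_ , s) (suc j) = smooth⇒pointwise q x xs s j

  pointwise⇒smooth : ∀ {m} p q (xs : Coloring m) → PointwiseSmooth p q xs → Smooth z p q xs
  pointwise⇒smooth p q []       h = h zero
  pointwise⇒smooth p q (x ∷ xs) h = h zero , pointwise⇒smooth q x xs (h ∘ suc)

lookup-∷ʳ : ∀ {m} (xs : Coloring m) z (j : Fin (suc m)) →
  (toℕ j ≡ m × lookup (xs ∷ʳ z) j ≡ z) ⊎
  (∃[ i ] toℕ i ≡ toℕ j × lookup xs i ≡ lookup (xs ∷ʳ z) j)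
lookup-∷ʳ []       z zero    = inj₁ (refl , refl)
lookup-∷ʳ (x ∷ xs) z zero    = inj₂ (zero , refl , refl)
lookup-∷ʳ (x ∷ xs) z (suc j) with lookup-∷ʳ xs z j
... | inj₁ (e , e′)     = inj₁ (cong suc e , e′)
... | inj₂ (i , e , e′) = inj₂ (suc i , cong suc e , e′)

-- Appending the first color `x` to `xs` simulates the wraparound: past the last vertex the cycle
-- returns to vertex `zero`, which has color `x`.
successor : ∀ {m} x y (xs : Coloring m) (j : Fin (suc m)) →
  ∃[ r ] Next (suc j) r × lookup (x ∷ y ∷ xs) r ≡ lookup (xs ∷ʳ x) j
successor x y xs j with lookup-∷ʳ xs x j
... | inj₁ (e , e′)     = zero , inj₂ (cong 2+ e , refl) , sym e′
... | inj₂ (i , e , e′) = suc (suc i) , inj₁ (cong 2+ e) , e′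

Next-inject₁ : ∀ {m} (j : Fin (suc m)) → Next (inject₁ j) (suc j)
Next-inject₁ j = inj₁ (cong suc (sym (toℕ-inject₁ j)))

stable⇒smooth : ∀ {m} (3≤n : 3 ≤ suc (suc m)) x y (xs : Coloring m) →
  Stable (cycle _ 3≤n) (x ∷ y ∷ xs) → Smooth x x y xs
stable⇒smooth 3≤n x y xs s = pointwise⇒smooth x x y xs λ j →
  let r , j→r , e = successor x y xs j in
  subst (Agrees _ _) e
    (kept⇒agrees 3≤n (x ∷ y ∷ xs) (Next-inject₁ j) j→r (stable⇒kept (cycle _ 3≤n) (x ∷ y ∷ xs) s (suc j)))

-- `Smooth` does not constrain vertex `zero`; the repeated first color makes that vertex agree with
-- its successor.
smooth⇒stable : ∀ {m} (3≤n : 3 ≤ suc (suc m)) x (xs : Coloring m) →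
  Smooth x x x xs → Stable (cycle _ 3≤n) (x ∷ x ∷ xs)
smooth⇒stable {m} 3≤n x xs s = kept⇒stable (cycle _ 3≤n) c λ
  -- The predecessor of vertex `zero` is the last vertex, inferred from `toℕ-fromℕ`.
  { zero    → agrees⇒kept 3≤n c {r = suc zero} (inj₂ (cong suc (toℕ-fromℕ (suc m)) , refl)) (inj₁ refl) (inj₂ refl)
  ; (suc j) → let r , j→r , e = successor x x xs j in
      agrees⇒kept 3≤n c (Next-inject₁ j) j→r
        (subst (Agrees _ _) (sym e) (smooth⇒pointwise x x x xs s j)) }
  where
  c = x ∷ x ∷ xs

-- Counting

count : ∀ {n} {P : Pred (Coloring n) 0ℓ} → Decidable P → ℕ
count P? = length (filter P? (allColorings _))

count-mono : ∀ {n} {P Q : Pred (Coloring n) 0ℓ} (P? : Decidable P) (Q? : Decidable Q) →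
  (∀ c → P c → Q c) → count P? ≤ count Q?
count-mono {n} P? Q? P⇒Q =
  length-mono-≤ (⊆-filter⁺ P? Q? (λ { refl → P⇒Q _ }) (⊆-refl {x = allColorings n}))

count-∅ : ∀ {n} {P : Pred (Coloring n) 0ℓ} (P? : Decidable P) → (∀ c → ¬ P c) → count P? ≡ 0
count-∅ {n} P? ¬P = cong length (filter-none P? (All.universal ¬P (allColorings n)))

count-cong : ∀ {n} {P Q : Pred (Coloring n) 0ℓ} (P? : Decidable P) (Q? : Decidable Q) →
  (∀ c → P c → Q c) → (∀ c → Q c → P c) → count P? ≡ count Q?
count-cong P? Q? P⇒Q Q⇒P = ℕ.≤-antisym (count-mono P? Q? P⇒Q) (count-mono Q? P? Q⇒P)

length-filter-map : ∀ {A B : Set} {P : Pred B 0ℓ} (P? : Decidable P) (f : A → B) xs →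
  length (filter P? (map f xs)) ≡ length (filter (P? ∘ f) xs)
length-filter-map P? f []       = refl
length-filter-map P? f (x ∷ xs) with P? (f x)
... | yes _ = cong suc (length-filter-map P? f xs)
... | no  _ = length-filter-map P? f xs

count-suc : ∀ {n} {P : Pred (Coloring (suc n)) 0ℓ} (P? : Decidable P) →
  count P? ≡ count (P? ∘ (b ∷_)) + count (P? ∘ (w ∷_))
count-suc {n} P? = begin
  length (filter P? (bs ++ ws ++ []))               ≡⟨ cong (λ l → length (filter P? (bs ++ l))) (++-identityʳ ws) ⟩
  length (filter P? (bs ++ ws))                     ≡⟨ cong length (filter-++ P? bs ws) ⟩
  length (filter P? bs ++ filter P? ws)             ≡⟨ length-++ (filter P? bs) ⟩
  length (filter P? bs) + length (filter P? ws)     ≡⟨ cong₂ _+_ (length-filter-map P? _ cs) (length-filter-map P? _ cs) ⟩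
  count (P? ∘ (b ∷_)) + count (P? ∘ (w ∷_))         ∎
  where
  open ≡-Reasoning
  cs = allColorings n
  bs = map (b ∷_) cs
  ws = map (w ∷_) cs

count-suc-by : ∀ {n} x {P : Pred (Coloring (suc n)) 0ℓ} (P? : Decidable P) →
  count P? ≡ count (P? ∘ (x ∷_)) + count (P? ∘ (other x ∷_))
count-suc-by b P? = count-suc P?
count-suc-by w P? = trans (count-suc P?) (ℕ.+-comm (count (P? ∘ (b ∷_))) (count (P? ∘ (w ∷_))))

-- Fibonacci bounds for paths

fib : ℕ → ℕ
fib zero          = 0
fib (suc zero)    = 1
fib (suc (suc n)) = fib (suc n) + fib n

fib≤fib-suc : ∀ n → fib n ≤ fib (suc n)
fib≤fib-suc zero    = z≤n
fib≤fib-suc (suc n) = ℕ.m≤m+n (fib (suc n)) (fib n)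

module _ (z : Color) where
  smoothCount : Color → Color → ℕ → ℕ
  smoothCount p q m = count (smooth? z p q {m})

  -- The second vertex already agrees with its predecessor, so the next color is free.
  smoothCount-same : ∀ p m → smoothCount p p (suc m) ≡ smoothCount p p m + smoothCount p (other p) m
  smoothCount-same p m = trans (count-suc-by p P?) (cong₂ _+_
    (count-cong (P? ∘ (p ∷_)) (smooth? z p p) (λ _ → proj₂) (λ _ s → inj₁ refl , s))
    (count-cong (P? ∘ (other p ∷_)) (smooth? z p (other p)) (λ _ → proj₂) (λ _ s → inj₁ refl , s)))
    where P? = smooth? z p p {suc m}

  -- The second vertex disagrees with its predecessor, so the next one must repeat its color and the
  -- branch of `p` is empty.
  smoothCount-change : ∀ p m → smoothCount p (other p) (suc m) ≡ smoothCount (other p) (other p) m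
  smoothCount-change p m = trans (count-suc-by p P?) (cong₂ _+_
    (count-∅ (P? ∘ (p ∷_)) λ { _ (inj₁ e , _) → other-≢ (sym e) ; _ (inj₂ e , _) → other-≢ (sym e) })
    (count-cong (P? ∘ (other p ∷_)) (smooth? z (other p) (other p)) (λ _ → proj₂) (λ _ s → inj₂ refl , s)))
    where P? = smooth? z p (other p) {suc m}

  -- Both counts are bounded in one induction, for all `p` since a change swaps the colors. At
  -- `m = 0` there is a single coloring, whence `fib 2` and `fib 1`, whatever `z` is.
  smoothCount-upper : ∀ m p →
    smoothCount p p m ≤ fib (2+ m) × smoothCount p (other p) m ≤ fib (suc m)
  smoothCount-upper zero p =
    length-filter (smooth? z p p) (allColorings 0) , length-filter (smooth? z p (other p)) (allColorings 0)
  smoothCount-upper (suc m) p =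
    let same , change = smoothCount-upper m p in
    ℕ.≤-trans (ℕ.≤-reflexive (smoothCount-same p m)) (ℕ.+-mono-≤ same change) ,
    ℕ.≤-trans (ℕ.≤-reflexive (smoothCount-change p m)) (proj₁ (smoothCount-upper m (other p)))

  -- The index is one lower than in the upper bound because at `m = 0` the vertex after a change may
  -- disagree with `z`, which leaves only the bound `fib 0`.
  smoothCount-lower : ∀ m p →
    fib (suc m) ≤ smoothCount p p m × fib m ≤ smoothCount p (other p) m
  smoothCount-lower zero p = filter-some (smooth? z p p) {xs = allColorings 0} (Any.here (inj₁ refl)) , z≤n
  smoothCount-lower (suc m) p =
    let same , change = smoothCount-lower m p in
    ℕ.≤-trans (ℕ.+-mono-≤ same change) (ℕ.≤-reflexive (sym (smoothCount-same p m))) ,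
    ℕ.≤-trans (proj₁ (smoothCount-lower m (other p))) (ℕ.≤-reflexive (sym (smoothCount-change p m)))

-- Fibonacci bounds for the cycle

module _ {m : ℕ} (3≤n : 3 ≤ 2+ m) where
  private
    S? : Decidable (Stable (cycle (2+ m) 3≤n))
    S? = stable? (cycle (2+ m) 3≤n)

    #from : Color → Color → ℕ
    #from x y = count (S? ∘ (x ∷_) ∘ (y ∷_))

    numStable-split : numStable (cycle (2+ m) 3≤n) ≡ (#from b b + #from b w) + (#from w b + #from w w)
    numStable-split = trans (count-suc S?)
      (cong₂ _+_ (count-suc (S? ∘ (b ∷_))) (count-suc (S? ∘ (w ∷_))))

    #from≤ : ∀ x y → #from x y ≤ smoothCount x x y m
    #from≤ x y = count-mono (S? ∘ (x ∷_) ∘ (y ∷_)) (smooth? x x y) (stable⇒smooth 3≤n x y)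

  fib≤numStable : fib (suc m) ≤ numStable (cycle (2+ m) 3≤n)
  fib≤numStable = begin
    fib (suc m)                                         ≤⟨ proj₁ (smoothCount-lower b m b) ⟩
    smoothCount b b b m                                 ≤⟨ count-mono (smooth? b b b) (S? ∘ (b ∷_) ∘ (b ∷_)) (smooth⇒stable 3≤n b) ⟩
    #from b b                                           ≤⟨ ℕ.m≤m+n _ _ ⟩
    #from b b + #from b w                               ≤⟨ ℕ.m≤m+n _ _ ⟩
    (#from b b + #from b w) + (#from w b + #from w w)   ≡⟨ numStable-split ⟨
    numStable (cycle (2+ m) 3≤n)                        ∎
    where open ℕ.≤-Reasoning

  numStable≤2fib : numStable (cycle (2+ m) 3≤n) ≤ fib (3 + m) + fib (3 + m)
  numStable≤2fib = ℕ.≤-trans (ℕ.≤-reflexive numStable-split) (ℕ.+-mono-≤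
    (ℕ.+-mono-≤ (ℕ.≤-trans (#from≤ b b) (proj₁ (smoothCount-upper b m b)))
                (ℕ.≤-trans (#from≤ b w) (proj₂ (smoothCount-upper b m b))))
    -- Swapping the summands puts the larger bound first, so that the two bounds add up to
    -- `fib (3 + m)` by definition.
    (ℕ.≤-trans (ℕ.≤-reflexive (ℕ.+-comm (#from w b) (#from w w)))
      (ℕ.+-mono-≤ (ℕ.≤-trans (#from≤ w w) (proj₁ (smoothCount-upper w m w)))
                  (ℕ.≤-trans (#from≤ w b) (proj₂ (smoothCount-upper w m w))))))

-- Comparison with powers of Φ

ι : ℕ → ℚ
ι n = + n / 1

-- Division in `ℚ` normalises by a gcd; over unnormalised rationals with denominator 1 the claim is
-- integer arithmetic.
ι-+ : ∀ m n → ι (m + n) ≡ ι m +ℚ ι n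
ι-+ m n = toℚᵘ-injective (begin
  toℚᵘ (ι (m + n))                 ≈⟨ toℚᵘ-fromℚᵘ (mkℚᵘ (+ (m + n)) 0) ⟩
  mkℚᵘ (+ (m + n)) 0               ≈⟨ *≡* (cong (ℤ._* + 1) (sym (cong₂ ℤ._+_ (ℤ.*-identityʳ (+ m)) (ℤ.*-identityʳ (+ n))))) ⟩
  mkℚᵘ (+ m) 0 ℚᵘ.+ mkℚᵘ (+ n) 0  ≈⟨ ℚᵘ.+-cong (toℚᵘ-fromℚᵘ (mkℚᵘ (+ m) 0)) (toℚᵘ-fromℚᵘ (mkℚᵘ (+ n) 0)) ⟨
  toℚᵘ (ι m) ℚᵘ.+ toℚᵘ (ι n)      ≈⟨ toℚᵘ-homo-+ (ι m) (ι n) ⟨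
  toℚᵘ (ι m +ℚ ι n)                ∎)
  where open SetoidReasoning ℚᵘ.≃-setoid

0≤ι : ∀ n → 0ℚ ≤ℚ ι n
0≤ι n = ℚ.nonNegative⁻¹ (ι n) {{ℚ.normalize-nonNeg n 1}}

0≤+ : ∀ {p q} → 0ℚ ≤ℚ p → 0ℚ ≤ℚ q → 0ℚ ≤ℚ p +ℚ q
0≤+ = ℚ.+-mono-≤

0≤* : ∀ {p q} → 0ℚ ≤ℚ p → 0ℚ ≤ℚ q → 0ℚ ≤ℚ p *ℚ q
0≤* {p} {q} 0≤p 0≤q = subst (_≤ℚ p *ℚ q) (ℚ.*-zeroʳ p)
  (ℚ.*-monoˡ-≤-nonNeg p {{nonNegative 0≤p}} 0≤q)

p≤p+q : ∀ {p q} → 0ℚ ≤ℚ q → p ≤ℚ p +ℚ q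
p≤p+q {p} {q} 0≤q = subst (_≤ℚ p +ℚ q) (ℚ.+-identityʳ p) (ℚ.+-monoʳ-≤ p 0≤q)

-- u + vΦ
fibΦ : ℚ → ℚ → ℚ√5
fibΦ u v = (u +ℚ ½ *ℚ v) +√5 (½ *ℚ v)

-- This is Φ² = Φ + 1: uΦ + vΦ² = v + (v + u)Φ.
Φ⊗fibΦ : ∀ u v → Φ ⊗ fibΦ u v ≡ fibΦ v (v +ℚ u)
Φ⊗fibΦ u v = cong₂ _+√5_
  (solve 2 (λ u v → con ½ :* (u :+ con ½ :* v) :+ con 5ℚ :* (con ½ :* (con ½ :* v))
                  := v :+ con ½ :* (v :+ u)) refl u v)
  (solve 2 (λ u v → con ½ :* (con ½ :* v) :+ con ½ :* (u :+ con ½ :* v)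
                  := con ½ :* (v :+ u)) refl u v)
  where open +-*-Solver

Φ^suc : ∀ n → Φ ^√ suc n ≡ fibΦ (ι (fib n)) (ι (fib (suc n)))
Φ^suc zero    = refl
Φ^suc (suc n) = trans (cong (Φ ⊗_) (Φ^suc n))
  (trans (Φ⊗fibΦ (ι (fib n)) (ι (fib (suc n))))
    (cong (fibΦ (ι (fib (suc n)))) (sym (ι-+ (fib (suc n)) (fib n)))))

nonNeg-both : ∀ {p q} → 0ℚ ≤ℚ p → 0ℚ ≤ℚ q → NonNeg (p +√5 q)
nonNeg-both {p} {q} 0≤p 0≤q with ℚ.≤-total (5ℚ *ℚ (q *ℚ q)) (p *ℚ p)
... | inj₁ l = inj₁ (0≤p , l)
... | inj₂ l = inj₂ (0≤q , l)

-- Uses √5 ≤ 3.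
nonNeg-3r+t-r√5 : ∀ {r t} → 0ℚ ≤ℚ r → 0ℚ ≤ℚ t → NonNeg ((ι 3 *ℚ r +ℚ t) +√5 (-ℚ r))
nonNeg-3r+t-r√5 {r} {t} 0≤r 0≤t = inj₁
  ( 0≤+ (0≤* (0≤ι 3) 0≤r) 0≤t
  , subst (5ℚ *ℚ (-ℚ r *ℚ -ℚ r) ≤ℚ_)
      (solve 2 (λ r t → con 5ℚ :* (:- r :* :- r) :+ (con (ι 4) :* (r :* r) :+ con (ι 6) :* (r :* t) :+ t :* t)
                      := (con (ι 3) :* r :+ t) :* (con (ι 3) :* r :+ t)) refl r t)
      (p≤p+q (0≤+ (0≤+ (0≤* (0≤ι 4) (0≤* 0≤r 0≤r)) (0≤* (0≤ι 6) (0≤* 0≤r 0≤t))) (0≤* 0≤t 0≤t))))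
  where open +-*-Solver

⅕ ⅒ ⅖ : ℚ
⅕ = + 1 / 5
⅒ = + 1 / 10
⅖ = + 2 / 5

-- Bounding √5 by 3, hence Φ by 2, turns the `fibΦ` term into at most 5f + 3g. The factor ⅕ makes f
-- cancel exactly and leaves the nonnegative remainder k + ⅖g.
⅕fibΦ≼ : ∀ {f g k} → 0ℚ ≤ℚ f → 0ℚ ≤ℚ g → 0ℚ ≤ℚ k →
  fromℚ ⅕ ⊗ fibΦ (f +ℚ g) ((f +ℚ g) +ℚ f) ≼ fromℚ ((f +ℚ g) +ℚ k)
⅕fibΦ≼ {f} {g} {k} 0≤f 0≤g 0≤k = subst NonNeg (sym (cong₂ _+√5_
    (solve 3 (λ f g k → (f :+ g :+ k) :- (con ⅕ :* (f :+ g :+ con ½ :* (f :+ g :+ f)) :+ con 5ℚ :* (con 0ℚ :* (con ½ :* (f :+ g :+ f))))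
                      := con (ι 3) :* (con ⅒ :* (f :+ g :+ f)) :+ (k :+ con ⅖ :* g)) refl f g k)
    (solve 2 (λ f g → con 0ℚ :- (con ⅕ :* (con ½ :* (f :+ g :+ f)) :+ con 0ℚ :* (f :+ g :+ con ½ :* (f :+ g :+ f)))
                      := :- (con ⅒ :* (f :+ g :+ f))) refl f g)))
  (nonNeg-3r+t-r√5
    (0≤* (ℚ.nonNegative⁻¹ ⅒) (0≤+ (0≤+ 0≤f 0≤g) 0≤f))
    (0≤+ 0≤k (0≤* (ℚ.nonNegative⁻¹ ⅖) 0≤g)))
  where open +-*-Solver

⅕Φ^≼ : ∀ m s → fib (suc m) ≤ s → fromℚ ⅕ ⊗ Φ ^√ (2+ m) ≼ fromℕ s
⅕Φ^≼ m s u≤s =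
  -- The inequalities become nonnegative gaps: k = s - F(m+1) and g = F(m+1) - F(m).
  let k , u+k≡s = ℕ.m≤n⇒∃[o]m+o≡n u≤s
      g , f+g≡u = ℕ.m≤n⇒∃[o]m+o≡n (fib≤fib-suc m)
      u-eq = trans (sym (ι-+ (fib m) g)) (cong ι f+g≡u)
  in subst₂ _≼_
    (cong (fromℚ ⅕ ⊗_) (trans
      (cong₂ fibΦ u-eq (trans (cong (_+ℚ ι (fib m)) u-eq) (sym (ι-+ (fib (suc m)) (fib m)))))
      (sym (Φ^suc (suc m)))))
    (cong fromℚ (trans (cong (_+ℚ ι k) u-eq) (trans (sym (ι-+ (fib (suc m)) k)) (cong ι u+k≡s))))
    (⅕fibΦ≼ (0≤ι (fib m)) (0≤ι g) (0≤ι k))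

-- Since 4(u + vΦ) = (4u + 2v) + 2v√5, the rational part alone already dominates s ≤ 2u + 2v, with
-- slack k + 2u.
≼4fibΦ : ∀ {u v s k} → 0ℚ ≤ℚ u → 0ℚ ≤ℚ v → 0ℚ ≤ℚ k → s +ℚ k ≡ (v +ℚ u) +ℚ (v +ℚ u) →
  fromℚ s ≼ fromℕ 4 ⊗ fibΦ u v
≼4fibΦ {u} {v} {s} {k} 0≤u 0≤v 0≤k s+k≡ = nonNeg-both
  (subst (0ℚ ≤ℚ_) rat-eq (0≤+ 0≤k (0≤* (0≤ι 2) 0≤u)))
  (subst (0ℚ ≤ℚ_)
    (solve 2 (λ u v → con (ι 2) :* v := (con (ι 4) :* (con ½ :* v) :+ con 0ℚ :* (u :+ con ½ :* v)) :- con 0ℚ) refl u v)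
    (0≤* (0≤ι 2) 0≤v))
  where
  open +-*-Solver

  rat-eq : k +ℚ ι 2 *ℚ u ≡ (ι 4 *ℚ (u +ℚ ½ *ℚ v) +ℚ 5ℚ *ℚ (0ℚ *ℚ (½ *ℚ v))) -ℚ s
  rat-eq = trans
    (solve 3 (λ u k s → k :+ con (ι 2) :* u := ((s :+ k) :+ con (ι 2) :* u) :- s) refl u k s)
    (trans (cong (λ x → (x +ℚ ι 2 *ℚ u) -ℚ s) s+k≡)
      (solve 3 (λ u v s → (((v :+ u) :+ (v :+ u)) :+ con (ι 2) :* u) :- s
                        := (con (ι 4) :* (u :+ con ½ :* v) :+ con 5ℚ :* (con 0ℚ :* (con ½ :* v))) :- s) refl u v s))

≼4Φ^ : ∀ m s → s ≤ fib (3 + m) + fib (3 + m) → fromℕ s ≼ fromℕ 4 ⊗ Φ ^√ (2+ m)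
≼4Φ^ m s s≤ =
  let k , s+k≡ = ℕ.m≤n⇒∃[o]m+o≡n s≤
      v+u = ι-+ (fib (2+ m)) (fib (suc m))
  in subst (λ x → fromℕ s ≼ fromℕ 4 ⊗ x) (sym (Φ^suc (suc m)))
    (≼4fibΦ (0≤ι (fib (suc m))) (0≤ι (fib (2+ m))) (0≤ι k)
      (trans (sym (ι-+ s k)) (trans (cong ι s+k≡)
        (trans (ι-+ (fib (3 + m)) (fib (3 + m))) (cong₂ _+ℚ_ v+u v+u)))))

theorem2p8 : ∃[ c₁ ] ∃[ c₂ ] ∃[ N ] (0# ≺ c₁ × 0# ≺ c₂ ×
    ((n : ℕ) (3≤n : 3 ≤ n) → N ≤ n →
    (c₁ ⊗ Φ ^√ n ≼ fromℕ (numStable (cycle n 3≤n))) ×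
    (fromℕ (numStable (cycle n 3≤n)) ≼ c₂ ⊗ Φ ^√ n)))
-- The threshold is 0: both bounds hold from the smallest cycle on.
theorem2p8 = fromℚ ⅕ , fromℕ 4 , 0
  , (nonNeg-both (ℚ.nonNegative⁻¹ ⅕) ℚ.≤-refl , λ ())
  , (nonNeg-both (0≤ι 4) ℚ.≤-refl , λ ())
  , λ { (suc (suc m)) 3≤n _ →
          ⅕Φ^≼ m _ (fib≤numStable 3≤n) , ≼4Φ^ m _ (numStable≤2fib 3≤n)
      ; (suc zero) (s≤s ()) _ }
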